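{- Let $P$ be a hereditary property of graphs, and let $P_n$ be its speed. Then the entropy of $P$ equals zero, that is, $\lim_{n\to\infty}\frac{\log_2 P_n}{\binom{n}{2}}=0$, if and only if there is a constant $k$ such that every graph $G\in P$ has VC-dimension $vc(G)\le k$.
   Context: All graphs are finite, simple and undirected. A graph property is an infinite class of graphs closed under isomorphism. A property is hereditary if it is closed under taking induced subgraphs. The speed of $P$ is the function $n\mapsto P_n$, where $P_n$ is the number of labelled graphs on the vertex set $\{1,\dots,n\}$ that belong to $P$. The entropy of $P$ is $\lim_{n\to\infty}\frac{\log_2 P_n}{\binom{n}{2}}$. The VC-dimension $vc(G)$ of a graph $G$ is the size of a largest set $A\subseteq V(G)$ such that for every subset $B\subseteq A$ there is a vertex $v\in V(G)\setminus A$ with $B=A\cap N(v)$, where $N(v)$ is the set of neighbours of $v$. -}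

module Defs where

open import Data.Bool using (Bool; false)
import Data.Bool.Properties as Bool
open import Data.Fin using (Fin)
open import Data.Fin.Properties using (any?)
open import Data.Fin.Subset using (Subset; inside; outside; _∩_; ∣_∣; _⊆_)
open import Data.Fin.Subset.Properties using (_∈?_; _⊆?_; anySubset?)
import Data.Fin.Subset as Subset
open import Data.Integer using (+_; -[1+_])
open import Data.List using (List; []; _∷_; _++_; map; filter)
open import Data.List.Extrema.Nat using (max)
open import Data.List.Relation.Unary.All using (All)
open import Data.Nat using (ℕ; zero; suc; _≤_; _<_; _*_; _^_)
open import Data.Nat.Combinatorics using (_C_)
open import Data.Product using (Σ-syntax; ∃; ∃-syntax; _×_; _,_; proj₁; proj₂)
open import Data.Rational.Unnormalised as ℚᵘ using (ℚᵘ; mkℚᵘ; 0ℚᵘ; _/_)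
open import Data.Vec using ([]; _∷_; tabulate)
import Data.Vec.Properties as Vec
open import Function.Bundles using (Inverse; _↔_)
open import Function.Definitions using (Injective)
open import Level using (Level; 0ℓ)
open import Relation.Binary.Bundles using (Setoid)
open import Relation.Binary.PropositionalEquality as ≡ using (_≡_)
open import Relation.Nullary using (Dec; ¬_)
open import Relation.Nullary.Decidable
  using (map′; ¬?; _×-dec_; _→-dec_; decidable-stable)
open import Relation.Unary using (Pred; _∈_)

private
  variable
    ℓ : Level
    n : ℕ

record Graph (n : ℕ) : Set where
  field
    adj       : Fin n → Fin n → Bool
    symmetric : ∀ i j → adj i j ≡ adj j i
    loopless  : ∀ i → adj i i ≡ false

open Graph public

-- Every finite graph is isomorphic to one with vertex set Fin n.
FiniteGraph : Set
FiniteGraph = ∃ Graph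

infix 4 _≈_ _≅_ _⊑_

-- Equality as labelled graphs.
_≈_ : Graph n → Graph n → Set
G ≈ H = ∀ i j → adj G i j ≡ adj H i j

_≅_ : FiniteGraph → FiniteGraph → Set
(m , G) ≅ (n , H) =
  Σ[ f ∈ Fin m ↔ Fin n ] ∀ i j → adj G i j ≡ adj H (Inverse.to f i) (Inverse.to f j)

-- H ⊑ G: up to relabelling its vertices by Fin m, H is the subgraph of G
-- induced by the image of f.
_⊑_ : FiniteGraph → FiniteGraph → Set
(m , H) ⊑ (n , G) =
  Σ[ f ∈ (Fin m → Fin n) ] Injective _≡_ _≡_ f × (∀ i j → adj H i j ≡ adj G (f i) (f j))

-- The class is infinite up to isomorphism: no finite list of graphs
-- exhausts it.
record IsGraphProperty (P : Pred FiniteGraph ℓ) : Set ℓ where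
  field
    infinite : ∀ (Gs : List FiniteGraph) → ∃[ G ] G ∈ P × All (λ H → ¬ G ≅ H) Gs
    iso-closed : ∀ {G H} → G ≅ H → G ∈ P → H ∈ P

record IsHereditaryProperty (P : Pred FiniteGraph ℓ) : Set ℓ where
  field
    isGraphProperty : IsGraphProperty P
    hereditary      : ∀ {G H} → H ⊑ G → G ∈ P → H ∈ P

-- The labelled graphs in P on n vertices.  Membership proofs are ignored
-- by the equality, so each labelled graph counts once.
labelled : Pred FiniteGraph ℓ → ℕ → Setoid ℓ 0ℓ
labelled P n = record
  { Carrier       = Σ[ G ∈ Graph n ] (n , G) ∈ P
  ; _≈_           = λ G H → proj₁ G ≈ proj₁ H
  ; isEquivalence = record
    { refl  = λ i j → ≡.refl
    ; sym   = λ p i j → ≡.sym (p i j)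
    ; trans = λ p q i j → ≡.trans (p i j) (q i j)
    }
  }

-- The function n ↦ Pₙ: there are exactly s n labelled graphs in P on n
-- vertices.
IsSpeed : Pred FiniteGraph ℓ → (ℕ → ℕ) → Set ℓ
IsSpeed P s = ∀ n → Inverse (labelled P n) (≡.setoid (Fin (s n)))

-- Comparison of a rational r = p / q, q > 0, with the real number log₂ x:
-- r < log₂ x iff 2ᵖ < x ^ q, a negative power of 2 being moved to the
-- other side of the inequality.  For x = 0 these give log₂ 0 = -∞.
infix 4 _<log₂_ _>log₂_

_<log₂_ : ℚᵘ → ℕ → Set
mkℚᵘ (+ p)    q-1 <log₂ x = 2 ^ p < x ^ suc q-1
mkℚᵘ -[1+ p ] q-1 <log₂ x = 1 < 2 ^ suc p * x ^ suc q-1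

_>log₂_ : ℚᵘ → ℕ → Set
mkℚᵘ (+ p)    q-1 >log₂ x = x ^ suc q-1 < 2 ^ p
mkℚᵘ -[1+ p ] q-1 >log₂ x = 2 ^ suc p * x ^ suc q-1 < 1

-- For a rational L: log₂ (s n) / (n C 2) tends to L.  The inequalities
-- L - ε < log₂ (s n) / (n C 2) < L + ε are multiplied by n C 2, which is
-- positive for n ≥ 2.
EntropyLimit : (ℕ → ℕ) → ℚᵘ → Set
EntropyLimit s L =
  ∀ (ε : ℚᵘ) → 0ℚᵘ ℚᵘ.< ε → ∃[ N ] ∀ n → N ≤ n →
    (((L ℚᵘ.- ε) ℚᵘ.* (+ (n C 2) / 1)) <log₂ s n) ×
    (((L ℚᵘ.+ ε) ℚᵘ.* (+ (n C 2) / 1)) >log₂ s n)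

neighbours : Graph n → Fin n → Subset n
neighbours G v = tabulate (adj G v)

Shattered : Graph n → Subset n → Set
Shattered G A =
  ∀ B → B ⊆ A → ∃[ v ] (v Subset.∉ A × B ≡ A ∩ neighbours G v)

private
  allSubset? : {Q : Pred (Subset n) ℓ} → (∀ B → Dec (Q B)) → Dec (∀ B → Q B)
  allSubset? Q? = map′
    (λ none B → decidable-stable (Q? B) (λ ¬q → none (B , ¬q)))
    (λ all (B , ¬q) → ¬q (all B))
    (¬? (anySubset? (λ B → ¬? (Q? B))))

shattered? : (G : Graph n) (A : Subset n) → Dec (Shattered G A)
shattered? G A = allSubset? λ B → (B ⊆? A) →-dec
  any? (λ v → ¬? (v ∈? A) ×-dec Vec.≡-dec Bool._≟_ B (A ∩ neighbours G v))

subsets : ∀ n → List (Subset n)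
subsets zero    = [] ∷ []
subsets (suc n) = map (inside ∷_) (subsets n) ++ map (outside ∷_) (subsets n)

-- The base value 0 of the maximum matters only for the graph with no
-- vertices: in every other graph the empty set is shattered.
vc : FiniteGraph → ℕ
vc (n , G) = max 0 (map ∣_∣ (filter (shattered? G) (subsets n)))

{-# OPTIONS --safe #-}
module Submission where

-- Unbounded VC-dimension: half of a shattered set of size 2n, together with vertices whose
-- neighbourhoods in that half are arbitrary, carries every n × n bipartite adjacency matrix, so
-- P has at least 2 ^ n² labelled graphs on 2n vertices.
--
-- VC-dimension at most k: split off a block of b vertices. By Sauer–Shelah the remaining m
-- vertices have at most (b + 1) ^ (k + 1) distinct neighbourhoods in the block, so, once it is
-- known which ones occur, the edges leaving the block take (k + 1) * log₂ (b + 1) bits per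
-- vertex. Removing block after block bounds log₂ Pₙ by (k + 1) * log₂ (b + 1) / b * n² up to a
-- term linear in n, and the factor of n² tends to 0 as b grows.

open import Defs
open import Data.Bool using (Bool; true; false; T; _∧_; _∨_; if_then_else_)
import Data.Bool.Properties as Bool
open import Data.Fin using
  (Fin; zero; suc; join; splitAt; combine; _↑ˡ_; _↑ʳ_; funToFin; finToFun; inject≤)
open import Data.Fin.Properties using
  ( _≟_; any?; suc-injective; injective⇒≤; inject≤-injective; ↑ˡ-injective; ↑ʳ-injective
  ; splitAt-↑ˡ; splitAt-↑ʳ; splitAt-join; join-splitAt; combine-injective
  ; funToFin-finToFin; finToFun-funToFin; 2↔Bool)
open import Data.Fin.Subset using (Subset; inside; outside; _∩_; ∣_∣; _⊆_; ⊥)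
  renaming (_∈_ to _∈ˢ_; _∉_ to _∉ˢ_)
open import Data.Fin.Subset.Properties using
  (drop-there; drop-∷-⊆; ∣⊥∣≡0; ∉⊥; ⊆-antisym; ⊆-min; ∩-zeroˡ)
open import Data.Integer as ℤ using (+_)
import Data.Integer.Properties as ℤ
open import Data.List using (List; []; _∷_; map; filter; allFin) renaming (_++_ to _++ˡ_)
open import Data.List.Extrema.Nat using (xs≤max; max≤v⁺)
import Data.List.Membership.Propositional as List
open import Data.List.Membership.Propositional.Properties using
  (∈-map⁺; ∈-++⁺ˡ; ∈-++⁺ʳ; ∈-filter⁺; ∈-allFin)
open import Data.List.Relation.Unary.All as All using (All)
import Data.List.Relation.Unary.All.Properties as All
import Data.List.Relation.Unary.Any as Any
open import Data.Nat as ℕ using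
  ( ℕ; zero; suc; pred; _+_; _*_; _^_; _⊔_; _≤_; _<_; _<?_; z≤n; s≤s; s≤s⁻¹
  ; NonZero; >-nonZero)
open import Data.Nat.Combinatorics using (_C_; nC1≡n; nCk+nC[k+1]≡[n+1]C[k+1])
open import Data.Nat.Induction using (<-rec)
open import Data.Nat.Properties hiding (_≟_; suc-injective)
open import Data.Nat.Tactic.RingSolver using (solve-∀)
open import Data.Product using (∃-syntax; Σ-syntax; _×_; _,_; proj₁; proj₂)
open import Data.Rational.Unnormalised as ℚᵘ using (mkℚᵘ; 0ℚᵘ; ½; *<*)
open import Data.Sum using (_⊎_; inj₁; inj₂; [_,_]′)
open import Data.Sum.Properties using (inj₁-injective; inj₂-injective)
open import Data.Vec as Vec using ([]; _∷_; _++_; tabulate; lookup; here; there)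
import Data.Vec.Properties as Vec
open import Function using (_∘_)
open import Function.Bundles using (_⇔_; mk⇔; Inverse; Injection)
open import Function.Construct.Identity using (↔-id)
open import Function.Construct.Symmetry using (↔-sym)
open import Function.Definitions using (Injective)
open import Function.Properties.Inverse using (↔⇒↣)
open import Level using (Level)
open import Relation.Binary.PropositionalEquality
open import Relation.Nullary using (¬_; contradiction; Dec; yes; no)
open import Relation.Nullary.Decidable using (isYes; isYes≗does; dec-true; toWitness)
open import Relation.Unary using (Pred; _∈_)

private
  variable
    k m n b d : ℕ
    ℓ : Level

-- Sauer–Shelah

Family : ℕ → Set
Family b = Subset b → Bool

Shatters : Family b → Subset b → Set
Shatters F S = ∀ B → B ⊆ S → ∃[ x ] (F x ≡ true × B ≡ S ∩ x)

either both : Family (suc b) → Family b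
either F x = F (outside ∷ x) ∨ F (inside ∷ x)
both   F x = F (outside ∷ x) ∧ F (inside ∷ x)

-- Every member of the projection `either F` lifts to a member of `F`, and any lift will do, since
-- the first coordinate lies outside the set.
either⇒shatters : (F : Family (suc b)) {S : Subset b} →
                  Shatters (either F) S → Shatters F (outside ∷ S)
either⇒shatters F sh (inside ∷ B) B⊆S with () ← B⊆S here
either⇒shatters F sh (outside ∷ B) B⊆S with sh B (drop-∷-⊆ B⊆S)
... | x , e , refl with F (outside ∷ x) in eq
... | true  = outside ∷ x , eq , refl
... | false = inside ∷ x , e , refl

-- A member of `both F` extends to `F` with either value of the first coordinate, so that coordinate
-- joins the shattered set.
both⇒shatters : (F : Family (suc b)) {S : Subset b} →
                Shatters (both F) S → Shatters F (inside ∷ S)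
both⇒shatters F sh (y ∷ B) B⊆S with sh B (drop-∷-⊆ B⊆S)
... | x , e , refl with F (outside ∷ x) in eq₀ | F (inside ∷ x) in eq₁ | y
... | true | true | inside  = inside ∷ x , eq₁ , refl
... | true | true | outside = outside ∷ x , eq₀ , refl

-- This is ∑ b C i over i ≤ d. The Sauer–Shelah bound for families shattering no d-set stops at
-- i < d; the extra term keeps `index` total at d = 0.
Φ : ℕ → ℕ → ℕ
Φ b       zero    = 1
Φ zero    (suc d) = 1
Φ (suc b) (suc d) = Φ b (suc d) + Φ b d

Φ≤[1+b]^d : ∀ b d → Φ b d ≤ suc b ^ d
Φ≤[1+b]^d b       zero    = ≤-refl
Φ≤[1+b]^d zero    (suc d) = m^n>0 1 (suc d)
Φ≤[1+b]^d (suc b) (suc d) = begin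
  Φ b (suc d) + Φ b d            ≤⟨ +-mono-≤ (Φ≤[1+b]^d b (suc d)) (Φ≤[1+b]^d b d) ⟩
  suc b * suc b ^ d + suc b ^ d  ≡⟨ +-comm _ (suc b ^ d) ⟩
  suc (suc b) * suc b ^ d        ≤⟨ *-monoʳ-≤ (suc (suc b)) (^-monoˡ-≤ d (n≤1+n (suc b))) ⟩
  suc (suc b) ^ suc d            ∎
  where open ≤-Reasoning

-- Of two members of F that differ in the first coordinate only, the one containing it is indexed
-- through both F, and all other members are indexed through either F.
index : (d : ℕ) → Family b → Subset b → Fin (Φ b d)
index         zero    F x             = zero
index         (suc d) F []            = zero
index {suc b} (suc d) F (outside ∷ x) = join (Φ b (suc d)) (Φ b d) (inj₁ (index (suc d) (either F) x))
index {suc b} (suc d) F (inside  ∷ x) = join (Φ b (suc d)) (Φ b d)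
  (if F (outside ∷ x) then inj₂ (index d (both F) x) else inj₁ (index (suc d) (either F) x))

index-cong : ∀ d {F F′ : Family b} → F ≗ F′ → index d F ≗ index d F′
index-cong zero    F≗F′ x  = refl
index-cong (suc d) F≗F′ [] = refl
index-cong (suc d) {F} {F′} F≗F′ (outside ∷ x) = cong (join _ _ ∘ inj₁)
  (index-cong (suc d) (λ z → cong₂ _∨_ (F≗F′ (outside ∷ z)) (F≗F′ (inside ∷ z))) x)
index-cong (suc d) {F} {F′} F≗F′ (inside ∷ x) with F (outside ∷ x) | F′ (outside ∷ x) | F≗F′ (outside ∷ x)
... | false | _ | refl = cong (join _ _ ∘ inj₁)
  (index-cong (suc d) (λ z → cong₂ _∨_ (F≗F′ (outside ∷ z)) (F≗F′ (inside ∷ z))) x)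
... | true | _ | refl = cong (join _ _ ∘ inj₂)
  (index-cong d (λ z → cong₂ _∧_ (F≗F′ (outside ∷ z)) (F≗F′ (inside ∷ z))) x)

join-injective : ∀ m n {u v : Fin m ⊎ Fin n} → join m n u ≡ join m n v → u ≡ v
join-injective m n {u} {v} eq = begin
  u                       ≡⟨ splitAt-join m n u ⟨
  splitAt m (join m n u)  ≡⟨ cong (splitAt m) eq ⟩
  splitAt m (join m n v)  ≡⟨ splitAt-join m n v ⟩
  v                       ∎
  where open ≡-Reasoning

-- `either F` shatters no set of size `suc d` and `both F` none of size `d`, so induction recovers
-- the tail. The side of the `join` settles the first coordinate: all members on the right contain
-- it, and on the left no two members share a tail.
index-injective : ∀ d (F : Family b) → (∀ S → ∣ S ∣ ≡ d → ¬ Shatters F S) →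
                  ∀ {x y} → F x ≡ true → F y ≡ true → index d F x ≡ index d F y → x ≡ y
-- A family with a member shatters the empty set.
index-injective {b} zero F none {x} Fx Fy eq = contradiction shatters-⊥ (none ⊥ (∣⊥∣≡0 b))
  where
  shatters-⊥ : Shatters F ⊥
  shatters-⊥ B B⊆⊥ = x , Fx , trans (⊆-antisym B⊆⊥ (⊆-min B)) (sym (∩-zeroˡ x))
index-injective (suc d) F none {[]} {[]} Fx Fy eq = refl
index-injective {suc b} (suc d) F none = go
  where
  none-either : ∀ S → ∣ S ∣ ≡ suc d → ¬ Shatters (either F) S
  none-either S ∣S∣ = none (outside ∷ S) ∣S∣ ∘ either⇒shatters F

  none-both : ∀ S → ∣ S ∣ ≡ d → ¬ Shatters (both F) S
  none-both S ∣S∣ = none (inside ∷ S) (cong suc ∣S∣) ∘ both⇒shatters F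

  outside⇒either : ∀ {x} → F (outside ∷ x) ≡ true → either F x ≡ true
  outside⇒either e rewrite e = refl

  inside⇒either : ∀ {x} → F (inside ∷ x) ≡ true → either F x ≡ true
  inside⇒either e rewrite e = Bool.∨-zeroʳ _

  by-either : ∀ {x y} → either F x ≡ true → either F y ≡ true →
              inj₁ {B = Fin (Φ b d)} (index (suc d) (either F) x) ≡ inj₁ (index (suc d) (either F) y) →
              x ≡ y
  by-either ex ey eq = index-injective (suc d) (either F) none-either ex ey (inj₁-injective eq)

  go : ∀ {x y} → F x ≡ true → F y ≡ true → index (suc d) F x ≡ index (suc d) F y → x ≡ y
  go {outside ∷ x} {outside ∷ y} Fx Fy eq =
    cong (outside ∷_) (by-either (outside⇒either Fx) (outside⇒either Fy)
      (join-injective (Φ b (suc d)) (Φ b d) {inj₁ _} {inj₁ _} eq))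
  go {outside ∷ x} {inside ∷ y} Fx Fy eq
    with F (outside ∷ y) in ey
       | join-injective (Φ b (suc d)) (Φ b d) {inj₁ _} {if F (outside ∷ y) then _ else _} eq
  -- Equal tails would make `outside ∷ y` a member, which `ey` denies.
  ... | false | eq′
    with refl ← by-either (outside⇒either Fx) (inside⇒either Fy) eq′
    with () ← trans (sym Fx) ey
  go {inside ∷ x} {outside ∷ y} Fx Fy eq
    with F (outside ∷ x) in ex
       | join-injective (Φ b (suc d)) (Φ b d) {if F (outside ∷ x) then _ else _} {inj₁ _} eq
  ... | false | eq′
    with refl ← by-either (inside⇒either Fx) (outside⇒either Fy) eq′
    with () ← trans (sym Fy) ex
  go {inside ∷ x} {inside ∷ y} Fx Fy eq
    with F (outside ∷ x) in ex | F (outside ∷ y) in ey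
       | join-injective (Φ b (suc d)) (Φ b d)
           {if F (outside ∷ x) then _ else _} {if F (outside ∷ y) then _ else _} eq
  ... | false | false | eq′ = cong (inside ∷_) (by-either (inside⇒either Fx) (inside⇒either Fy) eq′)
  ... | true  | true  | eq′ = cong (inside ∷_)
    (index-injective d (both F) none-both (cong₂ _∧_ ex Fx) (cong₂ _∧_ ey Fy) (inj₂-injective eq′))

-- This is 2 ^ 2 ^ b, the number of families on `b` points. It depends on the block size alone, so
-- it ends up in the constant factor of the recurrence.
tables : ℕ → ℕ
tables zero    = 2
tables (suc b) = tables b * tables b

table : Family b → Fin (tables b)
table {zero}  F = Inverse.from 2↔Bool (F [])
table {suc b} F = combine (table (F ∘ (outside ∷_))) (table (F ∘ (inside ∷_)))

table-injective : (F F′ : Family b) → table F ≡ table F′ → F ≗ F′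
table-injective F F′ eq [] = Injection.injective (↔⇒↣ (↔-sym 2↔Bool)) eq
table-injective {suc b} F F′ eq (y ∷ x)
  with combine-injective {tables b} (table (F ∘ (outside ∷_))) _ (table (F′ ∘ (outside ∷_))) _ eq | y
... | eqₒ , _ | outside = table-injective (F ∘ (outside ∷_)) (F′ ∘ (outside ∷_)) eqₒ x
... | _ , eqᵢ | inside  = table-injective (F ∘ (inside ∷_)) (F′ ∘ (inside ∷_)) eqᵢ x

-- Splitting off a block of vertices

∈-subsets : (A : Subset n) → A List.∈ subsets n
∈-subsets []            = Any.here refl
∈-subsets (inside ∷ A)  = ∈-++⁺ˡ (∈-map⁺ (inside ∷_) (∈-subsets A))
∈-subsets (outside ∷ A) = ∈-++⁺ʳ _ (∈-map⁺ (outside ∷_) (∈-subsets A))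

shattered⇒≤vc : (G : Graph n) {A : Subset n} → Shattered G A → ∣ A ∣ ≤ vc (n , G)
shattered⇒≤vc G sh = All.lookup (xs≤max 0 (map ∣_∣ (filter (shattered? G) (subsets _))))
  (∈-map⁺ ∣_∣ (∈-filter⁺ (shattered? G) (∈-subsets _) sh))

vc-lub : (G : Graph n) → (∀ A → Shattered G A → ∣ A ∣ ≤ k) → vc (n , G) ≤ k
vc-lub G sh≤k = max≤v⁺ z≤n (All.map⁺ (All.map (sh≤k _) (All.all-filter (shattered? G) (subsets _))))

induced : Graph n → (Fin m → Fin n) → Graph m
induced G f = record
  { adj       = λ i j → adj G (f i) (f j)
  ; symmetric = λ i j → symmetric G (f i) (f j)
  ; loopless  = λ i → loopless G (f i)
  }

↑ˡ∈++⁺ : (p : Subset m) (q : Subset n) {i : Fin m} → i ∈ˢ p → i ↑ˡ n ∈ˢ p ++ q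
↑ˡ∈++⁺ p q i∈p = Vec.lookup⇒[]= _ (p ++ q) (trans (Vec.lookup-++ˡ p q _) (Vec.[]=⇒lookup i∈p))

↑ˡ∈++⁻ : (p : Subset m) (q : Subset n) {i : Fin m} → i ↑ˡ n ∈ˢ p ++ q → i ∈ˢ p
↑ˡ∈++⁻ p q i∈ = Vec.lookup⇒[]= _ p (trans (sym (Vec.lookup-++ˡ p q _)) (Vec.[]=⇒lookup i∈))

↑ʳ∈++⁺ : (p : Subset m) (q : Subset n) {i : Fin n} → i ∈ˢ q → m ↑ʳ i ∈ˢ p ++ q
↑ʳ∈++⁺ p q i∈q = Vec.lookup⇒[]= _ (p ++ q) (trans (Vec.lookup-++ʳ p q _) (Vec.[]=⇒lookup i∈q))

↑ʳ∈++⁻ : (p : Subset m) (q : Subset n) {i : Fin n} → m ↑ʳ i ∈ˢ p ++ q → i ∈ˢ q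
↑ʳ∈++⁻ p q i∈ = Vec.lookup⇒[]= _ q (trans (sym (Vec.lookup-++ʳ p q _)) (Vec.[]=⇒lookup i∈))

∣++⊥∣ : (p : Subset m) → ∣ p ++ ⊥ {n} ∣ ≡ ∣ p ∣
∣++⊥∣ {n = n} []    = ∣⊥∣≡0 n
∣++⊥∣ (inside ∷ p)  = cong suc (∣++⊥∣ p)
∣++⊥∣ (outside ∷ p) = ∣++⊥∣ p

tabulate-+ : ∀ {a} {A : Set a} m (f : Fin (m + n) → A) →
             tabulate f ≡ tabulate (f ∘ (_↑ˡ n)) ++ tabulate (f ∘ (m ↑ʳ_))
tabulate-+ zero    f = refl
tabulate-+ (suc m) f = cong (f zero ∷_) (tabulate-+ m (f ∘ suc))

funToFin-injective : (f g : Fin m → Fin n) → funToFin f ≡ funToFin g → f ≗ g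
funToFin-injective f g eq i = begin
  f i                      ≡⟨ finToFun-funToFin f i ⟨
  finToFun (funToFin f) i  ≡⟨ cong (λ c → finToFun c i) eq ⟩
  finToFun (funToFin g) i  ≡⟨ finToFun-funToFin g i ⟩
  g i                      ∎
  where open ≡-Reasoning

module Blocks (b m : ℕ) where

  row : Graph (b + m) → Fin m → Subset b
  row G j = tabulate λ i → adj G (b ↑ʳ j) (i ↑ˡ m)

  row? : (G : Graph (b + m)) (x : Subset b) → Dec (∃[ j ] row G j ≡ x)
  row? G x = any? λ j → Vec.≡-dec Bool._≟_ (row G j) x

  rows : Graph (b + m) → Family b
  rows G x = isYes (row? G x)

  row∈rows : (G : Graph (b + m)) (j : Fin m) → rows G (row G j) ≡ true
  row∈rows G j = trans (isYes≗does (row? G _)) (dec-true (row? G _) (j , refl))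

  rows⇒row : (G : Graph (b + m)) {x : Subset b} → rows G x ≡ true → ∃[ j ] row G j ≡ x
  rows⇒row G {x} e = toWitness {a? = row? G x} (subst T (sym e) _)

  -- The vertices that provide the rows lie outside the block, hence outside `S ++ ⊥`, as
  -- `Shattered` demands of its witnesses.
  rows-shatter : (G : Graph (b + m)) {S : Subset b} → Shatters (rows G) S → Shattered G (S ++ ⊥)
  rows-shatter G {S} sh B B⊆ with Vec.splitAt b B
  ... | B₁ , B₂ , refl
    with sh B₁ (λ i∈ → ↑ˡ∈++⁻ S ⊥ (B⊆ (↑ˡ∈++⁺ B₁ B₂ i∈)))
  ... | x , x∈ , refl with rows⇒row G x∈
  ... | j , refl = b ↑ʳ j , ∉⊥ ∘ ↑ʳ∈++⁻ S ⊥ , sym (begin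
    (S ++ ⊥) ∩ neighbours G (b ↑ʳ j)          ≡⟨ cong ((S ++ ⊥) ∩_) (tabulate-+ b _) ⟩
    (S ++ ⊥) ∩ (row G j ++ tabulate _)        ≡⟨ Vec.zipWith-++ _∧_ S ⊥ (row G j) _ ⟩
    (S ∩ row G j) ++ (⊥ ∩ tabulate _)         ≡⟨ cong ((S ∩ row G j) ++_) (trans (∩-zeroˡ _) (sym B₂≡⊥)) ⟩
    (S ∩ row G j) ++ B₂                       ∎)
    where
    open ≡-Reasoning
    B₂≡⊥ : B₂ ≡ ⊥
    B₂≡⊥ = ⊆-antisym (λ i∈ → ↑ʳ∈++⁻ S ⊥ (B⊆ (↑ʳ∈++⁺ (S ∩ x) B₂ i∈))) (⊆-min B₂)

  -- The two indices are taken in different families; `index-cong` moves the second into `rows G`,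
  -- where both rows are members and `index-injective` applies.
  rows-determined : ∀ d (G H : Graph (b + m)) → (∀ S → ∣ S ∣ ≡ d → ¬ Shatters (rows G) S) →
                    rows G ≗ rows H →
                    (∀ j → index d (rows G) (row G j) ≡ index d (rows H) (row H j)) →
                    ∀ j → row G j ≡ row H j
  rows-determined d G H none rG≗rH eq j = index-injective d (rows G) none (row∈rows G j)
    (trans (rG≗rH _) (row∈rows H j)) (trans (eq j) (sym (index-cong d rG≗rH _)))

  blocks⇒≈ : (G H : Graph (b + m)) →
             induced G (_↑ˡ m) ≈ induced H (_↑ˡ m) → induced G (b ↑ʳ_) ≈ induced H (b ↑ʳ_) →
             (∀ j → row G j ≡ row H j) → G ≈ H
  blocks⇒≈ G H G≈Hˡ G≈Hʳ rows≡ i j =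
    subst₂ (λ i j → adj G i j ≡ adj H i j) (join-splitAt b m i) (join-splitAt b m j)
      (blockwise (splitAt b i) (splitAt b j))
    where
    cross : ∀ i j → adj G (b ↑ʳ j) (i ↑ˡ m) ≡ adj H (b ↑ʳ j) (i ↑ˡ m)
    cross i j = begin
      adj G (b ↑ʳ j) (i ↑ˡ m)  ≡⟨ Vec.lookup∘tabulate _ i ⟨
      lookup (row G j) i       ≡⟨ cong (λ r → lookup r i) (rows≡ j) ⟩
      lookup (row H j) i       ≡⟨ Vec.lookup∘tabulate _ i ⟩
      adj H (b ↑ʳ j) (i ↑ˡ m)  ∎
      where open ≡-Reasoning
    blockwise : ∀ u v → adj G (join b m u) (join b m v) ≡ adj H (join b m u) (join b m v)
    blockwise (inj₁ i) (inj₁ j) = G≈Hˡ i j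
    blockwise (inj₁ i) (inj₂ j) = trans (symmetric G _ _) (trans (cross i j) (symmetric H _ _))
    blockwise (inj₂ i) (inj₁ j) = cross j i
    blockwise (inj₂ i) (inj₂ j) = G≈Hʳ i j

induced-⊑ : (G : Graph n) {f : Fin m → Fin n} → Injective _≡_ _≡_ f → (m , induced G f) ⊑ (n , G)
induced-⊑ G {f} f-inj = f , f-inj , λ i j → refl

-- Counting labelled graphs

module _ {P : Pred FiniteGraph ℓ} {speed : ℕ → ℕ} (isSpeed : IsSpeed P speed) where

  Labelled : ℕ → Set ℓ
  Labelled n = Σ[ G ∈ Graph n ] (n , G) ∈ P

  number : Labelled n → Fin (speed n)
  number = Inverse.to (isSpeed _)

  nth : Fin (speed n) → Labelled n
  nth = Inverse.from (isSpeed _)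

  nth-number : (G : Labelled n) → proj₁ (nth (number G)) ≈ proj₁ G
  nth-number {n} G = Inverse.strictlyInverseʳ (isSpeed n) G

  number-injective : (G H : Labelled n) → number G ≡ number H → proj₁ G ≈ proj₁ H
  number-injective {n} G H eq i j = begin
    adj (proj₁ G) i j                 ≡⟨ nth-number G i j ⟨
    adj (proj₁ (nth (number G))) i j  ≡⟨ cong (λ c → adj (proj₁ (nth c)) i j) eq ⟩
    adj (proj₁ (nth (number H))) i j  ≡⟨ nth-number H i j ⟩
    adj (proj₁ H) i j                 ∎
    where open ≡-Reasoning

  nth-injective : (c c′ : Fin (speed n)) → proj₁ (nth c) ≈ proj₁ (nth c′) → c ≡ c′
  nth-injective {n} c c′ eq = begin
    c                ≡⟨ Inverse.strictlyInverseˡ (isSpeed n) c ⟨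
    number (nth c)   ≡⟨ Inverse.to-cong (isSpeed n) {nth c} {nth c′} eq ⟩
    number (nth c′)  ≡⟨ Inverse.strictlyInverseˡ (isSpeed n) c′ ⟩
    c′               ∎
    where open ≡-Reasoning

  -- The code `f` may depend on the membership proof, since `nth` fixes one representative for each
  -- labelled graph.
  speed≤ : (f : Labelled n → Fin k) → (∀ G H → f G ≡ f H → proj₁ G ≈ proj₁ H) → speed n ≤ k
  speed≤ f f-inj = injective⇒≤ {f = f ∘ nth} λ {c} {c′} eq → nth-injective c c′ (f-inj _ _ eq)

  ≤speed : (f : Fin k → Labelled n) → (∀ i j → proj₁ (f i) ≈ proj₁ (f j) → i ≡ j) → k ≤ speed n
  ≤speed f f-inj = injective⇒≤ {f = number ∘ f} λ {i} {j} eq → f-inj i j (number-injective (f i) (f j) eq)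

  module _ (hereditary : ∀ {G H} → H ⊑ G → G ∈ P → H ∈ P) where

    -- A graph is coded by its two induced subgraphs, the family of rows that occur, and the index
    -- of each row within that family. Heredity keeps both subgraphs in `P`, so the speed counts
    -- them.
    speed-recurrence : ∀ b m d →
                       (∀ {n} (G : Graph n) → (n , G) ∈ P → ∀ A → ∣ A ∣ ≡ d → ¬ Shattered G A) →
                       speed (b + m) ≤ (speed b * tables b) * (speed m * Φ b d ^ m)
    speed-recurrence b m d none = speed≤ code code-injective
      where
      open Blocks b m

      left : Labelled (b + m) → Labelled b
      left (G , G∈P) = induced G (_↑ˡ m) , hereditary (induced-⊑ G (↑ˡ-injective m _ _)) G∈P

      right : Labelled (b + m) → Labelled m
      right (G , G∈P) = induced G (b ↑ʳ_) , hereditary (induced-⊑ G (↑ʳ-injective b _ _)) G∈P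

      indices : Graph (b + m) → Fin m → Fin (Φ b d)
      indices G j = index d (rows G) (row G j)

      code : Labelled (b + m) → Fin ((speed b * tables b) * (speed m * Φ b d ^ m))
      code G′@(G , _) = combine (combine (number (left G′)) (table (rows G)))
                                (combine (number (right G′)) (funToFin (indices G)))

      code-injective : ∀ G H → code G ≡ code H → proj₁ G ≈ proj₁ H
      code-injective G′@(G , G∈P) H′@(H , H∈P) eq
        with eq₁ , eq₂ ← combine-injective (combine (number (left G′)) _) _ (combine (number (left H′)) _) _ eq
        with eqˡ , eqᵗ ← combine-injective (number (left G′)) _ (number (left H′)) _ eq₁
        with eqʳ , eqⁱ ← combine-injective (number (right G′)) _ (number (right H′)) _ eq₂
        = blocks⇒≈ G H (number-injective (left G′) (left H′) eqˡ) (number-injective (right G′) (right H′) eqʳ)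
            (rows-determined d G H none-rows (table-injective (rows G) (rows H) eqᵗ)
              (funToFin-injective (indices G) (indices H) eqⁱ))
        where
        none-rows : ∀ S → ∣ S ∣ ≡ d → ¬ Shatters (rows G) S
        none-rows S ∣S∣≡d sh =
          none G G∈P (S ++ ⊥) (trans (∣++⊥∣ S) ∣S∣≡d) (rows-shatter G sh)

-- Shattered sets realise all bipartite graphs

element : (A : Subset n) → k ≤ ∣ A ∣ → Fin k → Fin n
element []            ()      zero
element (outside ∷ A) k≤      i       = suc (element A k≤ i)
element (inside ∷ A)  (s≤s _) zero    = zero
element (inside ∷ A)  (s≤s p) (suc i) = suc (element A p i)

select : (A : Subset n) → k ≤ ∣ A ∣ → (Fin k → Bool) → Subset n
select []            _       f = []
select (outside ∷ A) k≤      f = outside ∷ select A k≤ f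
select (inside ∷ A)  z≤n     f = outside ∷ select A z≤n f
select (inside ∷ A)  (s≤s p) f = f zero ∷ select A p (f ∘ suc)

element-injective : (A : Subset n) (k≤ : k ≤ ∣ A ∣) → Injective _≡_ _≡_ (element A k≤)
element-injective []            ()      {zero}
element-injective (outside ∷ A) k≤      eq = element-injective A k≤ (suc-injective eq)
element-injective (inside ∷ A)  (s≤s p) {zero}  {zero}  eq = refl
element-injective (inside ∷ A)  (s≤s p) {suc i} {suc j} eq =
  cong suc (element-injective A p (suc-injective eq))

element∈ : (A : Subset n) (k≤ : k ≤ ∣ A ∣) (i : Fin k) → element A k≤ i ∈ˢ A
element∈ []            ()      zero
element∈ (outside ∷ A) k≤      i       = there (element∈ A k≤ i)
element∈ (inside ∷ A)  (s≤s p) zero    = here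
element∈ (inside ∷ A)  (s≤s p) (suc i) = there (element∈ A p i)

select⊆ : (A : Subset n) (k≤ : k ≤ ∣ A ∣) (f : Fin k → Bool) → select A k≤ f ⊆ A
select⊆ (outside ∷ A) k≤      f (there x∈) = there (select⊆ A k≤ f x∈)
select⊆ (inside ∷ A)  z≤n     f (there x∈) = there (select⊆ A z≤n f x∈)
select⊆ (inside ∷ A)  (s≤s p) f {zero}  _  = here
select⊆ (inside ∷ A)  (s≤s p) f {suc i} x∈ = there (select⊆ A p (f ∘ suc) (drop-there x∈))

lookup-select : (A : Subset n) (k≤ : k ≤ ∣ A ∣) (f : Fin k → Bool) (i : Fin k) →
                lookup (select A k≤ f) (element A k≤ i) ≡ f i
lookup-select []            ()      f zero
lookup-select (outside ∷ A) k≤      f i       = lookup-select A k≤ f i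
lookup-select (inside ∷ A)  (s≤s p) f zero    = refl
lookup-select (inside ∷ A)  (s≤s p) f (suc i) = lookup-select A p (f ∘ suc) i

-- Shattering is applied to the subset of `A` that `f` selects. At an element of `A` the
-- intersection with `A` drops out, which leaves adjacency to `v`.
shattered-realises : (G : Graph n) {A : Subset n} → Shattered G A → (k≤ : k ≤ ∣ A ∣) (f : Fin k → Bool) →
                     ∃[ v ] (v ∉ˢ A × ∀ i → adj G v (element A k≤ i) ≡ f i)
shattered-realises G {A} sh k≤ f with sh (select A k≤ f) (select⊆ A k≤ f)
... | v , v∉A , eq = v , v∉A , λ i → let a = element A k≤ i in begin
  adj G v a                                ≡⟨ Vec.lookup∘tabulate (adj G v) a ⟨
  lookup (neighbours G v) a                ≡⟨ cong (_∧ lookup (neighbours G v) a)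
    (Vec.[]=⇒lookup (element∈ A k≤ i)) ⟨
  lookup A a ∧ lookup (neighbours G v) a   ≡⟨ Vec.lookup-zipWith _∧_ a A (neighbours G v) ⟨
  lookup (A ∩ neighbours G v) a            ≡⟨ cong (λ B → lookup B a) eq ⟨
  lookup (select A k≤ f) a                 ≡⟨ lookup-select A k≤ f i ⟩
  f i                                      ∎
  where open ≡-Reasoning

-- Half of the shattered vertices form one side; the other half only serves to
-- separate the vertices realising the rows of M.
shattered⇒bipartite : (G : Graph m) {A : Subset m} → Shattered G A → n + n ≤ ∣ A ∣ →
                      (M : Fin n → Fin n → Bool) →
                      ∃[ H ] (n + n , H) ⊑ (m , G) × ∀ j i → adj H (n ↑ʳ j) (i ↑ˡ n) ≡ M j i
shattered⇒bipartite {m} {n} G {A} sh 2n≤ M =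
  induced G vertex , induced-⊑ G vertex-injective , cross
  where
  profile : Fin n → Fin n ⊎ Fin n → Bool
  profile j = [ M j , isYes ∘ (j ≟_) ]′

  realiser : ∀ j → ∃[ v ] (v ∉ˢ A × ∀ i → adj G v (element A 2n≤ i) ≡ profile j (splitAt n i))
  realiser j = shattered-realises G sh 2n≤ (profile j ∘ splitAt n)

  a v : Fin n → Fin m
  a i = element A 2n≤ (i ↑ˡ n)
  v j = proj₁ (realiser j)

  adj-v : ∀ j (u : Fin n ⊎ Fin n) → adj G (v j) (element A 2n≤ (join n n u)) ≡ profile j u
  adj-v j u = trans (proj₂ (proj₂ (realiser j)) (join n n u)) (cong (profile j) (splitAt-join n n u))

  a≢v : ∀ i j → a i ≢ v j
  a≢v i j eq = proj₁ (proj₂ (realiser j)) (subst (_∈ˢ A) eq (element∈ A 2n≤ _))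

  v-injective : Injective _≡_ _≡_ v
  v-injective {j} {j′} eq = sym (toWitness {a? = j′ ≟ j} (subst T (sym j′≟j) _))
    where
    j′≟j : isYes (j′ ≟ j) ≡ true
    j′≟j = begin
      isYes (j′ ≟ j)                            ≡⟨ adj-v j′ (inj₂ j) ⟨
      adj G (v j′) (element A 2n≤ (n ↑ʳ j))     ≡⟨ cong (λ w → adj G w _) eq ⟨
      adj G (v j) (element A 2n≤ (n ↑ʳ j))      ≡⟨ adj-v j (inj₂ j) ⟩
      isYes (j ≟ j)                             ≡⟨ isYes≗does (j ≟ j) ⟩
      _                                         ≡⟨ dec-true (j ≟ j) refl ⟩
      true                                      ∎
      where open ≡-Reasoning

  vertex : Fin (n + n) → Fin m
  vertex = [ a , v ]′ ∘ splitAt n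

  side-injective : ∀ x y → [ a , v ]′ x ≡ [ a , v ]′ y → x ≡ y
  side-injective (inj₁ i) (inj₁ j) eq = cong inj₁ (↑ˡ-injective n i j (element-injective A 2n≤ eq))
  side-injective (inj₁ i) (inj₂ j) eq = contradiction eq (a≢v i j)
  side-injective (inj₂ i) (inj₁ j) eq = contradiction (sym eq) (a≢v j i)
  side-injective (inj₂ i) (inj₂ j) eq = cong inj₂ (v-injective eq)

  vertex-injective : Injective _≡_ _≡_ vertex
  vertex-injective {x} {y} eq = begin
    x                       ≡⟨ join-splitAt n n x ⟨
    join n n (splitAt n x)  ≡⟨ cong (join n n) (side-injective (splitAt n x) (splitAt n y) eq) ⟩
    join n n (splitAt n y)  ≡⟨ join-splitAt n n y ⟩
    y                       ∎
    where open ≡-Reasoning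

  cross : ∀ j i → adj G (vertex (n ↑ʳ j)) (vertex (i ↑ˡ n)) ≡ M j i
  cross j i rewrite splitAt-↑ʳ n n j | splitAt-↑ˡ n i n = adj-v j (inj₁ i)

finToFun-injective : ∀ n m (c c′ : Fin (n ^ m)) → finToFun {n} {m} c ≗ finToFun c′ → c ≡ c′
finToFun-injective n m c c′ eq = begin
  c                                ≡⟨ funToFin-finToFin {m} {n} c ⟨
  funToFin (finToFun {n} {m} c)    ≡⟨ funToFin-cong eq ⟩
  funToFin (finToFun {n} {m} c′)   ≡⟨ funToFin-finToFin {m} {n} c′ ⟩
  c′                               ∎
  where
  open ≡-Reasoning
  funToFin-cong : ∀ {m} {f g : Fin m → Fin n} → f ≗ g → funToFin f ≡ funToFin g
  funToFin-cong {zero}  eq = refl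
  funToFin-cong {suc m} eq = cong₂ combine (eq zero) (funToFin-cong (eq ∘ suc))

-- Lower bounds on the speed

module _ {P : Pred FiniteGraph ℓ} (isHereditary : IsHereditaryProperty P)
         {speed : ℕ → ℕ} (isSpeed : IsSpeed P speed) where

  open IsHereditaryProperty isHereditary
  open IsGraphProperty isGraphProperty

  -- Each size has finitely many labelled members, so `infinite` can be asked to avoid all sizes
  -- below a given one. This yields arbitrarily large members of `P`.
  members-below : ℕ → List FiniteGraph
  members-below zero    = []
  members-below (suc m) = map (λ c → m , proj₁ (nth isSpeed c)) (allFin (speed m)) ++ˡ members-below m

  -- A member on exactly `m` vertices would be isomorphic, by the identity map, to its own entry in
  -- the list.
  avoids-members-below : ∀ m {n} (G : Graph n) → (n , G) ∈ P →
                         All (λ H → ¬ (n , G) ≅ H) (members-below m) → m ≤ n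
  avoids-members-below zero    G G∈P _ = z≤n
  avoids-members-below (suc m) G G∈P avoids = ≤∧≢⇒< (avoids-members-below m G G∈P (All.++⁻ʳ _ avoids)) λ where
    refl → All.lookup (All.map⁻ (All.++⁻ˡ (map _ (allFin (speed m))) avoids))
             (∈-allFin (number isSpeed (G , G∈P)))
             (↔-id _ , λ i j → sym (nth-number isSpeed (G , G∈P) i j))

  -- A large enough member restricts to `n` vertices. Positivity serves the lower inequality of the
  -- limit, which fails for log₂ 0 = -∞.
  speed>0 : ∀ n → 0 < speed n
  speed>0 n with infinite (members-below n)
  ... | (m , G) , G∈P , avoids = ≤speed isSpeed {k = 1} (λ _ → induced G _ ,
      hereditary (induced-⊑ G {λ i → inject≤ i n≤m} (inject≤-injective n≤m n≤m _ _)) G∈P)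
      λ { zero zero _ → refl }
    where
    n≤m : n ≤ m
    n≤m = avoids-members-below n G G∈P avoids

  -- Distinct matrices give distinct labelled graphs because the matrix can be read off the cross
  -- edges. The form `(2 ^ n) ^ n` comes from decoding a number into `n` rows and each row into `n`
  -- bits.
  shattered⇒2^n²≤speed : {G : Graph m} {A : Subset m} → (m , G) ∈ P → Shattered G A → n + n ≤ ∣ A ∣ →
                        (2 ^ n) ^ n ≤ speed (n + n)
  shattered⇒2^n²≤speed {m} {n} {G} G∈P sh 2n≤ = ≤speed isSpeed graph graph-injective
    where
    matrix : Fin ((2 ^ n) ^ n) → Fin n → Fin n → Bool
    matrix c j i = Inverse.to 2↔Bool (finToFun {2} {n} (finToFun {2 ^ n} {n} c j) i)

    graph : Fin ((2 ^ n) ^ n) → Labelled isSpeed (n + n)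
    graph c with H , H⊑G , _ ← shattered⇒bipartite G sh 2n≤ (matrix c) = H , hereditary H⊑G G∈P

    graph-injective : ∀ c c′ → proj₁ (graph c) ≈ proj₁ (graph c′) → c ≡ c′
    graph-injective c c′ eq = finToFun-injective (2 ^ n) n c c′ λ j → finToFun-injective 2 n _ _ λ i →
      Injection.injective (↔⇒↣ 2↔Bool) (begin
        matrix c j i                                  ≡⟨ cross c j i ⟨
        adj (proj₁ (graph c)) (n ↑ʳ j) (i ↑ˡ n)       ≡⟨ eq (n ↑ʳ j) (i ↑ˡ n) ⟩
        adj (proj₁ (graph c′)) (n ↑ʳ j) (i ↑ˡ n)      ≡⟨ cross c′ j i ⟩
        matrix c′ j i                                 ∎)
      where
      open ≡-Reasoning
      cross : ∀ c j i → adj (proj₁ (graph c)) (n ↑ʳ j) (i ↑ˡ n) ≡ matrix c j i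
      cross c = proj₂ (proj₂ (shattered⇒bipartite G sh 2n≤ (matrix c)))

-- Growth of the speed

2*nC2+n≡n*n : ∀ n → 2 * (n C 2) + n ≡ n * n
2*nC2+n≡n*n zero    = refl
2*nC2+n≡n*n (suc n) = begin
  2 * (suc n C 2) + suc n        ≡⟨ cong (λ c → 2 * c + suc n) (nCk+nC[k+1]≡[n+1]C[k+1] n 1) ⟨
  2 * (n C 1 + n C 2) + suc n    ≡⟨ cong (λ c → 2 * (c + n C 2) + suc n) (nC1≡n n) ⟩
  2 * (n + n C 2) + suc n        ≡⟨ regroup n (n C 2) ⟩
  (2 * (n C 2) + n) + 2 * n + 1  ≡⟨ cong (λ x → x + 2 * n + 1) (2*nC2+n≡n*n n) ⟩
  n * n + 2 * n + 1              ≡⟨ square n ⟩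
  suc n * suc n                  ∎
  where
  open ≡-Reasoning
  regroup : ∀ n c → 2 * (n + c) + suc n ≡ (2 * c + n) + 2 * n + 1
  regroup = solve-∀
  square : ∀ n → n * n + 2 * n + 1 ≡ suc n * suc n
  square = solve-∀

n<2^n : ∀ n → n < 2 ^ n
n<2^n zero    = s≤s z≤n
n<2^n (suc n) = begin-strict
  suc n          ≡⟨ +-comm 1 n ⟩
  n + 1          <⟨ +-mono-<-≤ (n<2^n n) (m^n>0 2 n) ⟩
  2 ^ n + 2 ^ n  ≡⟨ cong (_+_ (2 ^ n)) (+-identityʳ (2 ^ n)) ⟨
  2 ^ suc n      ∎
  where open ≤-Reasoning

-- This supplies the block size: with `suc b` a power of 2, log₂ (b + 1) is the integer `suc j`. The
-- choice j = 2c works because c and 2c + 1 are at most 2 ^ c and 2 ^ (c + 1).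
exponential-beats-linear : ∀ c → ∃[ j ] ∃[ b ] suc b ≡ 2 ^ suc j × c * suc j ≤ b
exponential-beats-linear c = c + c , pred (2 ^ suc (c + c)) , 
  suc-pred (2 ^ suc (c + c)) {{m^n≢0 2 (suc (c + c))}} , <⇒≤pred (begin-strict
  c * suc (c + c)      ≡⟨ cong (c *_) (+-suc c c) ⟨
  c * (c + suc c)      ≤⟨ *-monoʳ-≤ c (+-mono-≤ (<⇒≤ (n<2^n c)) (n<2^n c)) ⟩
  c * (2 ^ c + 2 ^ c)  ≡⟨ cong (λ x → c * (2 ^ c + x)) (+-identityʳ (2 ^ c)) ⟨
  c * 2 ^ suc c        <⟨ *-monoˡ-< (2 ^ suc c) {{m^n≢0 2 (suc c)}} (n<2^n c) ⟩
  2 ^ c * 2 ^ suc c    ≡⟨ ^-distribˡ-+-* 2 c (suc c) ⟨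
  2 ^ (c + suc c)      ≡⟨ cong (2 ^_) (+-suc c c) ⟩
  2 ^ suc (c + c)      ∎)
  where open ≤-Reasoning

initial-bound : (f : ℕ → ℕ) (b : ℕ) → ∃[ K ] ∀ i → i < b → f i ≤ K
initial-bound f zero    = 0 , λ _ ()
initial-bound f (suc b) with K , f≤K ← initial-bound f b = K ⊔ f b , bound
  where
  bound : ∀ i → i < suc b → f i ≤ K ⊔ f b
  bound i i<1+b with i ℕ.≟ b
  ... | yes refl = m≤n⊔m K (f b)
  ... | no  i≢b  = ≤-trans (f≤K i (≤∧≢⇒< (s≤s⁻¹ i<1+b) i≢b)) (m≤m⊔n K (f b))

-- Each block of b vertices contributes a constant factor X and τ bits per remaining vertex.
exponent-bound : ∀ (s : ℕ → ℕ) b τ X → 0 < b → (∀ m → s (b + m) ≤ X * (s m * 2 ^ (τ * m))) →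
                 ∃[ E ] ∀ n → ∃[ L ] s n ≤ 2 ^ L × b * L ≤ E * (1 + n) + τ * (n * n)
exponent-bound s b τ X b>0 recurrence = E , <-rec _ step
  where
  K = proj₁ (initial-bound s b)
  -- The summand `b * K` pays for the starting values below `b`. The summand `X` pays for the
  -- constant factor of each removed block, as a block raises `E * (1 + n)` by `b * E`.
  E = X + b * K

  Bound : ℕ → Set
  Bound n = ∃[ L ] s n ≤ 2 ^ L × b * L ≤ E * (1 + n) + τ * (n * n)

  step : ∀ n → (∀ {m} → m < n → Bound m) → Bound n
  step n rec with n <? b
  ... | yes n<b = s n , <⇒≤ (n<2^n (s n)) , (begin
    b * s n                      ≤⟨ *-monoʳ-≤ b (proj₂ (initial-bound s b) n n<b) ⟩
    b * K                        ≤⟨ m≤n+m (b * K) X ⟩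
    E                            ≤⟨ m≤m*n E (1 + n) ⟩
    E * (1 + n)                  ≤⟨ m≤m+n _ _ ⟩
    E * (1 + n) + τ * (n * n)    ∎)
    where open ≤-Reasoning
  ... | no n≮b with m , refl ← m≤n⇒∃[o]m+o≡n (≮⇒≥ n≮b)
               with L , s≤ , bL≤ ← rec {m} (m<n+m m b>0) = X + (L + τ * m) , s≤′ , (begin
    b * (X + (L + τ * m))                             ≡⟨ regroup b X L (τ * m) ⟩
    b * X + b * L + b * (τ * m)                       ≤⟨ +-monoˡ-≤ _
      (+-mono-≤ (*-monoʳ-≤ b (m≤m+n X (b * K))) bL≤) ⟩
    -- The slack completes the square: (b + m)² exceeds m² by b² + 2bm, of which the bits leaving
    -- the block need only bm.
    b * E + (E * (1 + m) + τ * (m * m)) + b * (τ * m) ≤⟨ m≤m+n _ (τ * (b * b + b * m)) ⟩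
    b * E + (E * (1 + m) + τ * (m * m)) + b * (τ * m) + τ * (b * b + b * m)
                                                      ≡⟨ square b m E τ ⟩
    E * (1 + (b + m)) + τ * ((b + m) * (b + m))       ∎)
    where
    open ≤-Reasoning
    s≤′ : s (b + m) ≤ 2 ^ (X + (L + τ * m))
    s≤′ = begin
      s (b + m)                            ≤⟨ recurrence m ⟩
      X * (s m * 2 ^ (τ * m))              ≤⟨ *-mono-≤ (<⇒≤ (n<2^n X)) (*-monoˡ-≤ _ s≤) ⟩
      2 ^ X * (2 ^ L * 2 ^ (τ * m))        ≡⟨ cong (2 ^ X *_) (^-distribˡ-+-* 2 L (τ * m)) ⟨
      2 ^ X * 2 ^ (L + τ * m)              ≡⟨ ^-distribˡ-+-* 2 X (L + τ * m) ⟨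
      2 ^ (X + (L + τ * m))                ∎
    regroup : ∀ b X L t → b * (X + (L + t)) ≡ b * X + b * L + b * t
    regroup = solve-∀
    square : ∀ b m E τ → b * E + (E * (1 + m) + τ * (m * m)) + b * (τ * m) + τ * (b * b + b * m) ≡
                         E * (1 + (b + m)) + τ * ((b + m) * (b + m))
    square = solve-∀

-- After multiplying by `4 * b` and adding `2 * b * n`, the right side is 2bn². The quadratic term
-- on the left takes at most half of it by `4 * q * τ ≤ b`, and the linear terms take less than the
-- other half once `n` is large.
exponent<binomial : ∀ b q τ E L n → 0 < b → 4 * q * τ ≤ b → b * L ≤ E * (1 + n) + τ * (n * n) →
                  3 + 2 * (4 * q * E) ≤ n → L * q < n C 2
exponent<binomial b q τ E L n@(suc n-1) b>0 4qτ≤b bL≤ N≤n = *-cancelˡ-< (4 * b) (L * q) (n C 2)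
  (+-cancelʳ-< (2 * b * n) _ _ (begin-strict
  4 * b * (L * q) + 2 * b * n                             ≡⟨ cong (_+ 2 * b * n) (regroup b L q) ⟩
  4 * q * (b * L) + 2 * b * n                             ≤⟨ +-monoˡ-≤ _ (*-monoʳ-≤ (4 * q) bL≤) ⟩
  4 * q * (E * (1 + n) + τ * (n * n)) + 2 * b * n         ≡⟨ distribute q E τ n (2 * b * n) ⟩
  F * (1 + n) + (4 * q * τ) * (n * n) + 2 * b * n         ≤⟨ +-monoˡ-≤ (2 * b * n)
    (+-mono-≤ (m≤n*m (F * (1 + n)) b) (*-monoˡ-≤ (n * n) 4qτ≤b)) ⟩
  b * (F * (1 + n)) + b * (n * n) + 2 * b * n             ≡⟨ factor b (F * (1 + n)) n ⟩
  b * ((F * (1 + n) + 2 * n) + n * n)                     <⟨ *-monoʳ-< b (+-monoˡ-< (n * n) lower-order) ⟩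
  b * (n * n + n * n)                                     ≡⟨ cong (λ x → b * (x + x)) (2*nC2+n≡n*n n) ⟨
  b * ((2 * (n C 2) + n) + (2 * (n C 2) + n))             ≡⟨ double b (n C 2) n ⟩
  4 * b * (n C 2) + 2 * b * n                             ∎))
  where
  open ≤-Reasoning
  instance _ = >-nonZero b>0
  F = 4 * q * E
  regroup : ∀ b L q → 4 * b * (L * q) ≡ 4 * q * (b * L)
  regroup = solve-∀
  distribute : ∀ q E τ n x → 4 * q * (E * (1 + n) + τ * (n * n)) + x ≡
               (4 * q * E) * (1 + n) + (4 * q * τ) * (n * n) + x
  distribute = solve-∀
  factor : ∀ b x n → b * x + b * (n * n) + 2 * b * n ≡ b * ((x + 2 * n) + n * n)
  factor = solve-∀
  double : ∀ b c n → b * ((2 * c + n) + (2 * c + n)) ≡ 4 * b * c + 2 * b * n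
  double = solve-∀
  -- Since n is positive, 1 + n is at most 2n, so 2 + 2F would do for a weak inequality; the 3 makes
  -- it strict.
  lower-order : F * (1 + n) + 2 * n < n * n
  lower-order = begin-strict
    F * (1 + n) + 2 * n        ≤⟨ +-monoˡ-≤ (2 * n) (*-monoʳ-≤ F (s≤s (m≤n+m n n-1))) ⟩
    F * (n + n) + 2 * n        <⟨ +-monoʳ-< (F * (n + n)) (*-monoˡ-< n (n<1+n 2)) ⟩
    F * (n + n) + 3 * n        ≡⟨ collect F n ⟩
    (3 + 2 * F) * n            ≤⟨ *-monoˡ-≤ n N≤n ⟩
    n * n                      ∎
    where
    collect : ∀ F n → F * (n + n) + 3 * n ≡ (3 + 2 * F) * n
    collect = solve-∀

-- The conclusion is log₂ (s n) < (n C 2) / q in integers. The conjunct `0 < n C 2` later makes the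
-- lower bound of the limit strictly negative.
recurrence⇒subquadratic : ∀ (s : ℕ → ℕ) b τ X q → 0 < b → 4 * q * τ ≤ b →
                          (∀ m → s (b + m) ≤ X * (s m * 2 ^ (τ * m))) →
                          ∃[ N ] ∀ n → N ≤ n → 0 < n C 2 × s n ^ q < 2 ^ (n C 2)
recurrence⇒subquadratic s b τ X q b>0 4qτ≤b recurrence
  with E , exponent ← exponent-bound s b τ X b>0 recurrence = 3 + 2 * (4 * q * E) , λ n N≤n →
    let L , s≤2^L , bL≤ = exponent n
        Lq<nC2 = exponent<binomial b q τ E L n b>0 4qτ≤b bL≤ N≤n
    in ≤-<-trans z≤n Lq<nC2 , (begin-strict
      s n ^ q        ≤⟨ ^-monoˡ-≤ q s≤2^L ⟩
      (2 ^ L) ^ q    ≡⟨ ^-*-assoc 2 L q ⟩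
      2 ^ (L * q)    <⟨ ^-monoʳ-< 2 ≤-refl Lq<nC2 ⟩
      2 ^ (n C 2)    ∎)
  where open ≤-Reasoning

-- The entropy limit in integers, and the two implications

ε*c : ∀ p q c → (0ℚᵘ ℚᵘ.+ mkℚᵘ (+ suc p) q) ℚᵘ.* (+ c ℚᵘ./ 1) ≡ mkℚᵘ (+ (suc p * c)) q
ε*c p q c = cong₂ mkℚᵘ
  (trans (cong (λ x → + suc x ℤ.* + c) (*-identityʳ p)) (sym (ℤ.pos-* (suc p) c)))
  (trans (*-identityʳ (q + 0)) (+-identityʳ q))

1<2^[1+e]*y : ∀ e {y} → 0 < y → 1 < 2 ^ suc e * y
1<2^[1+e]*y e y>0 = *-mono-≤ (^-monoʳ-≤ 2 (s≤s (z≤n {e}))) y>0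

-- The rational is negative, while log₂ of a positive integer is at least 0. The explicit arguments
-- in the proof are what numerator and denominator of the product compute to.
-ε*c<log₂ : ∀ p q {c x} → 0 < c → 0 < x →
            ((0ℚᵘ ℚᵘ.- mkℚᵘ (+ suc p) q) ℚᵘ.* (+ c ℚᵘ./ 1)) <log₂ x
-ε*c<log₂ p q {suc c} {suc x} _ _ = 1<2^[1+e]*y (c + p * 1 * suc c) (m^n>0 (suc x) (suc ((q + 0) * 1)))

-- With ε = ½ the limit gives speed (2n) ² < 2 ^ (2n C 2) for large n, while a shattered set of
-- size 2n forces speed (2n) ≥ 2 ^ n².
entropy⇒bounded-vc : (P : Pred FiniteGraph ℓ) → IsHereditaryProperty P →
                     ∀ speed → IsSpeed P speed → EntropyLimit speed 0ℚᵘ →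
                     ∃[ k ] (∀ G → G ∈ P → vc G ≤ k)
entropy⇒bounded-vc P isHereditary speed isSpeed limit
  with N , close ← limit ½ (*<* (ℤ.+<+ (s≤s z≤n))) = N + N , bound
  where
  small : speed (N + N) ^ 2 < 2 ^ ((N + N) C 2)
  small = subst (λ e → speed (N + N) ^ 2 < 2 ^ e) (*-identityˡ ((N + N) C 2))
    (subst (_>log₂ speed (N + N)) (ε*c 0 1 ((N + N) C 2)) (proj₂ (close (N + N) (m≤m+n N N))))

  -- The binomial equals 2N² - N, and 2N² is the exponent of the squared lower bound
  -- `(2 ^ (N * N)) ^ 2`.
  binomial≤ : (N + N) C 2 ≤ N * N * 2
  binomial≤ = *-cancelˡ-≤ 2 (begin
    2 * ((N + N) C 2)            ≤⟨ m≤m+n _ (N + N) ⟩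
    2 * ((N + N) C 2) + (N + N)  ≡⟨ 2*nC2+n≡n*n (N + N) ⟩
    (N + N) * (N + N)            ≡⟨ square N ⟩
    2 * (N * N * 2)              ∎)
    where
    open ≤-Reasoning
    square : ∀ N → (N + N) * (N + N) ≡ 2 * (N * N * 2)
    square = solve-∀

  bound : ∀ G → G ∈ P → vc G ≤ N + N
  bound (m , G) G∈P = vc-lub G λ A sh → ≮⇒≥ λ 2N<∣A∣ → <-irrefl refl (begin-strict
    speed (N + N) ^ 2     <⟨ small ⟩
    2 ^ ((N + N) C 2)     ≤⟨ ^-monoʳ-≤ 2 binomial≤ ⟩
    2 ^ (N * N * 2)       ≡⟨ ^-*-assoc 2 (N * N) 2 ⟨
    (2 ^ (N * N)) ^ 2     ≡⟨ cong (_^ 2) (^-*-assoc 2 N N) ⟨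
    ((2 ^ N) ^ N) ^ 2     ≤⟨ ^-monoˡ-≤ 2
      (shattered⇒2^n²≤speed isHereditary isSpeed {n = N} G∈P sh (<⇒≤ 2N<∣A∣)) ⟩
    speed (N + N) ^ 2     ∎)
    where open ≤-Reasoning

module _ {P : Pred FiniteGraph ℓ} (isHereditary : IsHereditaryProperty P)
         {speed : ℕ → ℕ} (isSpeed : IsSpeed P speed) {k} (vc≤k : ∀ G → G ∈ P → vc G ≤ k) where

  -- No set of size `suc k` is shattered, so the Sauer-Shelah bound `suc b ^ suc k` is exactly
  -- `2 ^ (j * suc k)`: each row costs `j * suc k` bits.
  block-recurrence : ∀ b j → suc b ≡ 2 ^ j → ∀ m →
                     speed (b + m) ≤ speed b * tables b * (speed m * 2 ^ (j * suc k * m))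
  block-recurrence b j 1+b≡2^j m = begin
    speed (b + m)
      ≤⟨ speed-recurrence isSpeed hereditary b m (suc k) none ⟩
    speed b * tables b * (speed m * Φ b (suc k) ^ m)
      ≤⟨ *-monoʳ-≤ (speed b * tables b) (*-monoʳ-≤ (speed m) Φ^m≤) ⟩
    speed b * tables b * (speed m * 2 ^ (j * suc k * m))
      ∎
    where
    open IsHereditaryProperty isHereditary using (hereditary)
    open ≤-Reasoning
    none : ∀ {n} (G : Graph n) → (n , G) ∈ P → ∀ A → ∣ A ∣ ≡ suc k → ¬ Shattered G A
    none G G∈P A ∣A∣≡1+k sh = 1+n≰n (begin
      suc k        ≡⟨ ∣A∣≡1+k ⟨
      ∣ A ∣        ≤⟨ shattered⇒≤vc G sh ⟩
      vc (_ , G)   ≤⟨ vc≤k (_ , G) G∈P ⟩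
      k            ∎)
    Φ^m≤ : Φ b (suc k) ^ m ≤ 2 ^ (j * suc k * m)
    Φ^m≤ = begin
      Φ b (suc k) ^ m        ≤⟨ ^-monoˡ-≤ m (Φ≤[1+b]^d b (suc k)) ⟩
      (suc b ^ suc k) ^ m    ≡⟨ cong (λ x → (x ^ suc k) ^ m) 1+b≡2^j ⟩
      ((2 ^ j) ^ suc k) ^ m  ≡⟨ cong (_^ m) (^-*-assoc 2 j (suc k)) ⟩
      (2 ^ (j * suc k)) ^ m  ≡⟨ ^-*-assoc 2 (j * suc k) m ⟩
      2 ^ (j * suc k * m)    ∎

  bounded-vc⇒subquadratic : ∀ q .{{_ : NonZero q}} →
                            ∃[ N ] ∀ n → N ≤ n → 0 < n C 2 × speed n ^ q < 2 ^ (n C 2)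
  bounded-vc⇒subquadratic q@(suc _)
    -- With τ = `suc j * suc k`, the factor `4 * q * suc k` yields `4 * q * τ ≤ b`; being positive,
    -- it also yields `0 < b`.
    with j , b , 1+b≡2^j , cj≤b ← exponential-beats-linear (4 * q * suc k) =
    recurrence⇒subquadratic speed b (suc j * suc k) (speed b * tables b) q
      (≤-trans (s≤s z≤n) cj≤b)
      (≤-trans (≤-reflexive (regroup (4 * q) (suc j) (suc k))) cj≤b)
      (block-recurrence b (suc j) 1+b≡2^j)
    where
    regroup : ∀ x j d → x * (j * d) ≡ x * d * j
    regroup = solve-∀

-- A positive ε is at least the reciprocal of its denominator, so `q` is taken to be that
-- denominator and the numerator only helps.
subquadratic⇒entropy : ∀ s → (∀ n → 0 < s n) →
                       (∀ q .{{_ : NonZero q}} → ∃[ N ] ∀ n → N ≤ n → 0 < n C 2 × s n ^ q < 2 ^ (n C 2)) →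
                       EntropyLimit s 0ℚᵘ
subquadratic⇒entropy s s>0 sub (mkℚᵘ (+ zero) q-1) (*<* (ℤ.+<+ ()))
subquadratic⇒entropy s s>0 sub (mkℚᵘ (+ suc p) q-1) _ = proj₁ (sub (suc q-1)) , λ n N≤n →
  -ε*c<log₂ p q-1 (proj₁ (proj₂ (sub (suc q-1)) n N≤n)) (s>0 n) ,
  subst (_>log₂ s n) (sym (ε*c p q-1 (n C 2)))
    (<-≤-trans (proj₂ (proj₂ (sub (suc q-1)) n N≤n)) (^-monoʳ-≤ 2 (m≤n*m (n C 2) (suc p))))

theorem13 : ∀ {ℓ : Level} (P : Pred FiniteGraph ℓ) → IsHereditaryProperty P →
    ∀ (speed : ℕ → ℕ) → IsSpeed P speed →
    EntropyLimit speed 0ℚᵘ ⇔ (∃[ k ] (∀ G → G ∈ P → vc G ≤ k))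
theorem13 P isHereditary speed isSpeed = mk⇔
  (entropy⇒bounded-vc P isHereditary speed isSpeed)
  λ (k , vc≤k) → subquadratic⇒entropy speed (speed>0 isHereditary isSpeed)
    (bounded-vc⇒subquadratic isHereditary isSpeed vc≤k)
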